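{- Let $\kappa$ be an infinite regular cardinal and let $\varphi$ be a linear order type of size $\kappa$. Then for all $n<\omega$ and all $\kappa$-saturated linear order types $\tau$, $\tau \longrightarrow (\varphi, n)^2$.
   Context: A linear order $P$ (and its order type) is $\kappa$-saturated if $P\neq\emptyset$ and, for all $A,B\subseteq P$ (one or both possibly empty) with $|A|,|B|<\kappa$ and $A<_P B$ (i.e. $a<_P b$ for all $a\in A$, $b\in B$), there is $c\in P$ with $A<_P c<_P B$. The size of an order type is the cardinality of any order of that type. For linear order types $\tau,\varphi$ and $n<\omega$, $\tau\longrightarrow(\varphi,n)^2$ means: whenever $P$ is a linear order of type $\tau$ and $f:[P]^2\to\{0,1\}$ (where $[P]^2$ is the set of two-element subsets of $P$), either there is a suborder $Q\subseteq P$ of type $\varphi$ with $f$ constantly $0$ on $[Q]^2$, or there is $Q\subseteq P$ with $n$ elements with $f$ constantly $1$ on $[Q]^2$. -}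

module Defs where

open import Data.Fin.Base using (Fin; zero; suc)
open import Data.Nat.Base using (ℕ)
open import Data.Product.Base using (Σ; ∃; _×_; _,_; proj₁; proj₂)
open import Data.Sum.Base using (_⊎_; inj₁; inj₂)
open import Function.Bundles using (Func; Injection; Bijection)
open import Induction.WellFounded using (WellFounded)
open import Level using (Level; _⊔_) renaming (suc to lsuc)
open import Relation.Binary.Bundles using (Setoid; StrictTotalOrder)
open import Relation.Binary.Core using (Rel)
open import Relation.Binary.Morphism.Structures using (IsOrderIsomorphism)
open import Relation.Binary.PropositionalEquality.Core using (_≡_)
open import Relation.Binary.PropositionalEquality.Properties using (setoid)
open import Relation.Binary.Structures using (IsStrictTotalOrder)
open import Relation.Nullary.Negation.Core using (¬_)
open import Relation.Unary using (Pred; _∈_)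
import Relation.Binary.Construct.On as On

private
  variable
    a b r s ℓ : Level

-- Sets are setoids, so that a subset A can be given by an arbitrary predicate:
-- elements of `Sub S A` are compared by their first components only, hence
-- different proofs of membership do not produce different elements.

Sub : (S : Setoid a r) → Pred (Setoid.Carrier S) ℓ → Setoid (a ⊔ ℓ) r
Sub S A = On.setoid S (proj₁ {B = A})

infix 4 _≼_ _≺_ _≋_

_≼_ : Setoid a r → Setoid b s → Set (a ⊔ b ⊔ r ⊔ s)
S ≼ T = Injection S T

_≺_ : Setoid a r → Setoid b s → Set (a ⊔ b ⊔ r ⊔ s)
S ≺ T = S ≼ T × ¬ (T ≼ S)

_≋_ : Setoid a r → Setoid b s → Set (a ⊔ b ⊔ r ⊔ s)
S ≋ T = Bijection S T

-- A cardinal is an initial ordinal: a well-order whose proper initial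
-- segments all have strictly smaller cardinality.

record Cardinal ℓ : Set (lsuc ℓ) where
  infix 4 _<_
  field
    Carrier            : Set ℓ
    _<_                : Rel Carrier ℓ
    isStrictTotalOrder : IsStrictTotalOrder _≡_ _<_
    wellFounded        : WellFounded _<_

  set : Setoid ℓ ℓ
  set = setoid Carrier

  field
    initial : ∀ k → Sub set (_< k) ≺ set

  Cofinal : Pred Carrier ℓ → Set ℓ
  Cofinal X = ∀ k → ∃ λ x → x ∈ X × (k ≡ x ⊎ k < x)

  Infinite : Set ℓ
  Infinite = setoid ℕ ≼ set

  -- The cofinality of κ is κ.
  Regular : Set (lsuc ℓ)
  Regular = ∀ (X : Pred Carrier ℓ) → Cofinal X → ¬ (Sub set X ≺ set)

LinearOrder : ∀ ℓ → Set (lsuc ℓ)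
LinearOrder ℓ = StrictTotalOrder ℓ ℓ ℓ

-- Order types are given by representatives; P has the type of Q when P ≅ Q.

infix 4 _≅_

_≅_ : LinearOrder ℓ → LinearOrder ℓ → Set ℓ
P ≅ Q = ∃ (IsOrderIsomorphism P._≈_ Q._≈_ P._<_ Q._<_)
  where module P = StrictTotalOrder P
        module Q = StrictTotalOrder Q

underlying : LinearOrder ℓ → Setoid ℓ ℓ
underlying P = StrictTotalOrder.Eq.setoid P

HasSize : LinearOrder ℓ → Cardinal ℓ → Set ℓ
HasSize P κ = underlying P ≋ Cardinal.set κ

SubOrder : (P : LinearOrder ℓ) → Pred (StrictTotalOrder.Carrier P) ℓ → LinearOrder ℓ
SubOrder P Q = On.strictTotalOrder P (proj₁ {B = Q})

record Saturated (κ : Cardinal ℓ) (P : LinearOrder ℓ) : Set (lsuc ℓ) where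
  open StrictTotalOrder P using (Carrier; _<_)

  Small : Pred Carrier ℓ → Set ℓ
  Small A = Sub (underlying P) A ≺ Cardinal.set κ

  field
    nonempty : Carrier
    between  : ∀ (A B : Pred Carrier ℓ) → Small A → Small B →
               (∀ {x y} → x ∈ A → y ∈ B → x < y) →
               ∃ λ c → (∀ {x} → x ∈ A → x < c) × (∀ {y} → y ∈ B → c < y)

-- The two-element subsets {x , y}: pairs of distinct elements, two pairs being
-- equal when they agree up to swapping.

[_]² : Setoid a r → Setoid (a ⊔ r) r
[ S ]² = record
  { Carrier       = Σ (Carrier × Carrier) λ (x , y) → ¬ (x ≈ y)
  ; _≈_           = λ ((x , y) , _) ((u , v) , _) →
                      (x ≈ u × y ≈ v) ⊎ (x ≈ v × y ≈ u)
  ; isEquivalence = record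
    { refl  = inj₁ (refl , refl)
    ; sym   = λ { (inj₁ (p , q)) → inj₁ (sym p , sym q)
                ; (inj₂ (p , q)) → inj₂ (sym q , sym p) }
    ; trans = λ { (inj₁ (p , q)) (inj₁ (p′ , q′)) → inj₁ (trans p p′ , trans q q′)
                ; (inj₁ (p , q)) (inj₂ (p′ , q′)) → inj₂ (trans p p′ , trans q q′)
                ; (inj₂ (p , q)) (inj₁ (p′ , q′)) → inj₂ (trans p q′ , trans q p′)
                ; (inj₂ (p , q)) (inj₂ (p′ , q′)) → inj₁ (trans p q′ , trans q p′) }
    }
  }
  where open Setoid S

Coloring : LinearOrder ℓ → Set ℓ
Coloring P = Func [ underlying P ]² (setoid (Fin 2))

ConstantlyOn : (P : LinearOrder ℓ) → Coloring P → Fin 2 →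
               Pred (StrictTotalOrder.Carrier P) ℓ → Set ℓ
ConstantlyOn P f i Q = ∀ {x y} → x ∈ Q → y ∈ Q → (x≉y : ¬ (x ≈ y)) →
                       Func.to f ((x , y) , x≉y) ≡ i
  where open StrictTotalOrder P using (_≈_)

infix 4 _⟶⟨_,_⟩²

_⟶⟨_,_⟩² : LinearOrder ℓ → LinearOrder ℓ → ℕ → Set (lsuc ℓ)
_⟶⟨_,_⟩² {ℓ} τ φ n =
  ∀ (P : LinearOrder ℓ) → P ≅ τ → ∀ (f : Coloring P) →
    (∃ λ Q → SubOrder P Q ≅ φ × ConstantlyOn P f zero Q)
  ⊎ (∃ λ Q → Sub (underlying P) Q ≋ setoid (Fin n) × ConstantlyOn P f (suc zero) Q)

{-# OPTIONS --safe #-}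

-- Call a set small when κ does not inject into it. The core is the lemma
-- `avoid`: if a saturated S is met by fewer than κ sets N j, none of which
-- contains a saturated subset of S, then some element of S avoids them all,
-- because the gaps that witness non-saturation, whose union is small by
-- regularity, cut S down to a nonempty interval. The theorem follows by
-- induction on n. If S ∩ Edge x contains a saturated set for some x ∈ S, where
-- Edge x consists of the y with f {x , y} = 1, then x extends a clique found
-- there. Otherwise φ, enumerated in order type κ, is embedded recursively, and
-- `avoid` keeps every new point out of the sets Edge x of all earlier points x.

module Submission where

open import Defs
open import Axiom.ExcludedMiddle using (ExcludedMiddle)
open import Axiom.Extensionality.Propositional
  using (Extensionality; implicit-extensionality; lower-extensionality)
import Data.Empty as Empty
open import Data.Empty.Polymorphic using (⊥)
open import Data.Fin.Base using (Fin; zero; suc)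
import Data.Fin.Properties as Fin
open import Data.Nat.Base using (ℕ; zero; suc)
open import Data.Product.Base using (Σ; ∃; _×_; _,_; proj₁; proj₂)
open import Data.Sum.Base using (_⊎_; inj₁; inj₂; [_,_]′)
open import Data.Unit.Polymorphic.Base using (⊤; tt)
open import Function.Base using (_∘_; _on_)
open import Function.Bundles using (Func; Injection; Bijection)
open import Induction.WellFounded using (WfRec; module All; module FixPoint)
open import Level using (Level; _⊔_; Lift; lift; lower) renaming (suc to lsuc)
open import Relation.Binary.Bundles using (Setoid; StrictTotalOrder)
open import Relation.Binary.Definitions using (tri<; tri≈; tri>)
open import Relation.Binary.Morphism.Structures using (IsOrderIsomorphism)
open import Relation.Binary.PropositionalEquality
  using (_≡_; _≢_; refl; sym; trans; cong; subst; setoid)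
open import Relation.Binary.Structures using (IsStrictTotalOrder)
open import Relation.Nullary using (¬_; yes; no; contradiction)
open import Relation.Nullary.Decidable using (decidable-stable; map′)
open import Relation.Unary using (Pred; _∈_; _∉_; _⊆_; _∩_; _∪_)

¬∀⇒∃¬ : ∀ {a b} → ExcludedMiddle b → ExcludedMiddle (a ⊔ b) →
        {A : Set a} {B : A → Set b} → ¬ (∀ x → B x) → ∃ λ x → ¬ B x
¬∀⇒∃¬ emᵇ emᵃᵇ ¬∀ = decidable-stable emᵃᵇ λ ¬∃ →
  ¬∀ λ x → decidable-stable emᵇ λ ¬Bx → ¬∃ (x , ¬Bx)

-- Recursion with choices along the well-order κ.

module Smallness {ℓ : Level} (em⁺ : ExcludedMiddle (lsuc ℓ))
                 (ext : Extensionality (lsuc ℓ) (lsuc ℓ))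
                 (κ : Cardinal ℓ) (regular : Cardinal.Regular κ) where

  open Cardinal κ public using (_<_; set; initial; wellFounded) renaming (Carrier to K)
  open IsStrictTotalOrder (Cardinal.isStrictTotalOrder κ) public
    using (compare) renaming (trans to <-trans; irrefl to <-irrefl)

  em : ExcludedMiddle ℓ
  em = map′ lower lift (em⁺ {Lift (lsuc ℓ) _})

  module _ {x r : Level} (ext₁ : Extensionality ℓ (ℓ ⊔ x)) {X : Set x}
           (R : ∀ k → WfRec _<_ (λ _ → X) k → X → Set r)
           (step : ∀ k (h : WfRec _<_ (λ _ → X) k) → ∃ (R k h)) where

    private
      rec : ∀ k → WfRec _<_ (λ _ → X) k → X
      rec k h = proj₁ (step k h)

      rec-ext : ∀ k {h h′ : WfRec _<_ (λ _ → X) k} →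
                (∀ {j} j<k → h {j} j<k ≡ h′ j<k) → rec k h ≡ rec k h′
      rec-ext k {h} {h′} h≗h′ =
        cong {A = WfRec _<_ (λ _ → X) k} (λ h → rec k (λ {j} → h {j}))
          (implicit-extensionality ext₁ {A = K} {B = λ j → j < k → X}
            (lower-extensionality {b₁ = x} ℓ ℓ ext₁ h≗h′))

      open FixPoint wellFounded (λ _ → X) rec rec-ext

    abstract
      -- Well-founded recursion on the first components of `step`. Extensionality identifies
      -- histories with equal values, so the recursion unfolds and the second components give `R`
      -- for `g` itself.
      recursive-choice : ∃ λ (g : K → X) → ∀ k → R k (λ {j} _ → g j) (g k)
      recursive-choice = g , λ k → subst (R k _) (sym unfold-wfRec) (proj₂ (step k _))
        where
        g : K → X
        g = All.wfRec wellFounded _ (λ _ → X) rec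

  module _ {X : Set ℓ} (x₀ : X) (G : K → K → X → X → Set ℓ) where

    private
      Coherent : ∀ k → WfRec _<_ (λ _ → X) k → Set ℓ
      Coherent k h = ∀ {i j} (i<k : i < k) (j<k : j < k) → i < j → G i j (h i<k) (h j<k)

      -- The witness j<k need not be the given one, as proofs of j < k may differ.
      Next : ∀ k → WfRec _<_ (λ _ → X) k → X → Set ℓ
      Next k h x = ∀ {j} → j < k → ∃ λ (j<k : j < k) → G j k (h j<k) x

    abstract
      -- `step` handles total functions coherent below `k`, so a history is first padded with `x₀`.
      -- Coherence is itself an outcome of the choices: it becomes a premise of the relation given
      -- to `recursive-choice` and is discharged afterwards by induction.
      pairwise-choice : (∀ k (g : K → X) → (∀ {i j} → i < j → j < k → G i j (g i) (g j)) →
                          ∃ λ x → ∀ {j} → j < k → G j k (g j) x) →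
                        ∃ λ (g : K → X) → ∀ {j k} → j < k → G j k (g j) (g k)
      pairwise-choice step = g , λ {j} {k} → coherent k
        where
        next : ∀ k (h : WfRec _<_ (λ _ → X) k) → ∃ λ x → Coherent k h → Next k h x
        next k h with em {Coherent k h}
        -- A junk value: by the induction in `coherent`, this case never arises for the function
        -- finally built.
        ... | no ¬c = x₀ , λ c → Empty.⊥-elim (¬c c)
        ... | yes c = proj₁ (step k total G-total) , λ _ {j} j<k →
          let j<k′ , eq = total-≡ j<k in
          j<k′ , subst (λ y → G j k y _) eq (proj₂ (step k total G-total) j<k)
          where
          total : K → X
          total j with em {j < k}
          ... | yes j<k = h j<k
          ... | no _    = x₀

          total-≡ : ∀ {j} → j < k → ∃ λ (j<k : j < k) → total j ≡ h j<k
          total-≡ {j} j<k with em {j < k}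
          ... | yes j<k′ = j<k′ , refl
          ... | no j≮k   = contradiction j<k j≮k

          G-total : ∀ {i j} → i < j → j < k → G i j (total i) (total j)
          G-total i<j j<k
            with i<k′ , eqᵢ ← total-≡ (<-trans i<j j<k) | j<k′ , eqⱼ ← total-≡ j<k
            rewrite eqᵢ | eqⱼ = c i<k′ j<k′ i<j

        chosen : ∃ λ (g : K → X) → ∀ k → Coherent k (λ {j} _ → g j) → Next k (λ {j} _ → g j) (g k)
        chosen = recursive-choice (lower-extensionality (lsuc ℓ) (lsuc ℓ) ext)
                   (λ k h x → Coherent k h → Next k h x) next

        g : K → X
        g = proj₁ chosen

        coherent : ∀ k {j} → j < k → G j k (g j) (g k)
        coherent = All.wfRec wellFounded ℓ (λ k → ∀ {j} → j < k → G j k (g j) (g k)) λ k ih j<k →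
          proj₂ (proj₂ chosen k (λ _ j<k i<j → ih j<k i<j) j<k)

  -- Small sets: bounds and closure under unions.

  abstract
    least : (Q : Pred K ℓ) → ∃ Q → ∃ λ m → m ∈ Q × (∀ {j} → j < m → j ∉ Q)
    least Q (k , k∈Q) = All.wfRec wellFounded ℓ (λ k → k ∈ Q → _) minimise k k∈Q
      where
      minimise : ∀ k → WfRec _<_ (λ k → k ∈ Q → ∃ λ m → m ∈ Q × (∀ {j} → j < m → j ∉ Q)) k →
                 k ∈ Q → ∃ λ m → m ∈ Q × (∀ {j} → j < m → j ∉ Q)
      minimise k ih k∈Q with em {∃ λ j → j < k × j ∈ Q}
      ... | yes (j , j<k , j∈Q) = ih j<k j∈Q
      ... | no ¬∃ = k , k∈Q , λ j<k j∈Q → ¬∃ (_ , j<k , j∈Q)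

  -- Only the negative half of `≺ set` is kept, so that closure proofs just refute an injection from
  -- κ; `small⇒≺` restores the other half.
  IsSmall : Setoid ℓ ℓ → Set ℓ
  IsSmall S = ¬ (set ≼ S)

  module _ (S : Setoid ℓ ℓ) where
    private module S = Setoid S

    κ≼ : (g : K → S.Carrier) → (∀ {i j} → g i S.≈ g j → i ≡ j) → set ≼ S
    κ≼ g inj = record { to = g ; cong = λ { refl → S.refl } ; injective = inj }

    κ≼-separated : (g : K → S.Carrier) → (∀ {i j} → i < j → ¬ (g i S.≈ g j)) → set ≼ S
    κ≼-separated g sep = κ≼ g inj
      where
      inj : ∀ {i j} → g i S.≈ g j → i ≡ j
      inj {i} {j} eq with compare i j
      ... | tri< i<j _ _ = contradiction eq (sep i<j)
      ... | tri≈ _ i≡j _ = i≡j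
      ... | tri> _ _ j<i = contradiction (S.sym eq) (sep j<i)

    abstract
      -- Points go to the least index of an equal value of `g`; leastness makes equal points share
      -- an index.
      covered⇒≼ : (g : K → S.Carrier) → (∀ x → ∃ λ k → x S.≈ g k) → S ≼ set
      covered⇒≼ g cover = record
        { to        = index
        ; cong      = λ {x} {y} x≈y → index-cong x≈y
        ; injective = λ {x} {y} eq →
            S.trans (index-≈ x) (S.trans (S.reflexive (cong g eq)) (S.sym (index-≈ y)))
        }
        where
        first : ∀ x → ∃ λ m → x S.≈ g m × (∀ {j} → j < m → ¬ (x S.≈ g j))
        first x = least (λ k → x S.≈ g k) (cover x)

        index : S.Carrier → K
        index x = proj₁ (first x)

        index-≈ : ∀ x → x S.≈ g (index x)
        index-≈ x = proj₁ (proj₂ (first x))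

        index-cong : ∀ {x y} → x S.≈ y → index x ≡ index y
        index-cong {x} {y} x≈y with compare (index x) (index y)
        ... | tri< lt _ _ = contradiction (S.trans (S.sym x≈y) (index-≈ x)) (proj₂ (proj₂ (first y)) lt)
        ... | tri≈ _ eq _ = eq
        ... | tri> _ _ gt = contradiction (S.trans x≈y (index-≈ y)) (proj₂ (proj₂ (first x)) gt)

    abstract
      -- If no family indexed by `K` covers `S`, every family misses a point, and recursion builds
      -- an injection from κ into `S`, contrary to smallness.
      small⇒≼ : IsSmall S → S ≼ set
      small⇒≼ small with em {S.Carrier}
      ... | no empty = record
        { to        = λ x → contradiction x empty
        ; cong      = λ {x} _ → contradiction x empty
        ; injective = λ {x} _ → contradiction x empty
        }
      ... | yes x₀ with em {∃ λ (g : K → S.Carrier) → ∀ x → ∃ λ k → x S.≈ g k}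
      ...   | yes (g , cover) = covered⇒≼ g cover
      ...   | no ¬cover = contradiction (κ≼-separated (proj₁ separated) (proj₂ separated)) small
        where
        separated : ∃ λ (g : K → S.Carrier) → ∀ {j k} → j < k → ¬ (g j S.≈ g k)
        separated = pairwise-choice x₀ (λ _ _ x y → ¬ (x S.≈ y)) λ k g _ →
          let x , x∉g = ¬∀⇒∃¬ em em (λ cover → ¬cover (g , cover)) in
          x , λ _ eq → x∉g (_ , S.sym eq)

    small⇒≺ : IsSmall S → S ≺ set
    small⇒≺ small = small⇒≼ small , small

  small-↣ : (S T : Setoid ℓ ℓ) (h : Setoid.Carrier S → Setoid.Carrier T) →
            (∀ {x y} → Setoid._≈_ T (h x) (h y) → Setoid._≈_ S x y) →
            IsSmall T → IsSmall S
  small-↣ S T h inj small e =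
    small (κ≼ T (h ∘ Injection.to e) (Injection.injective e ∘ inj))

  segment-small : ∀ k → IsSmall (Sub set (_< k))
  segment-small k = proj₂ (initial k)

  abstract
    -- By regularity a small set is not cofinal; in a linear order the witness to this is a strict
    -- upper bound.
    small⇒bounded : (X : Pred K ℓ) → IsSmall (Sub set X) → ∃ λ b → ∀ {k} → k ∈ X → k < b
    small⇒bounded X small = b , below
      where
      unreached : ∃ λ b → ¬ (∃ λ x → x ∈ X × (b ≡ x ⊎ b < x))
      unreached = ¬∀⇒∃¬ em em λ cofinal → regular X cofinal (small⇒≺ (Sub set X) small)

      b : K
      b = proj₁ unreached

      below : ∀ {k} → k ∈ X → k < b
      below {k} k∈X with compare k b
      ... | tri< k<b _ _ = k<b
      ... | tri≈ _ k≡b _ = contradiction (k , k∈X , inj₁ (sym k≡b)) (proj₂ unreached)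
      ... | tri> _ _ b<k = contradiction (k , k∈X , inj₂ b<k) (proj₂ unreached)

  module _ (S : Setoid ℓ ℓ) where
    private module S = Setoid S

    abstract
      -- An injection of κ into the union would cover `K` by two bounded sets, but the larger of the
      -- bounds lies in neither.
      ∪-small : (A B : Pred S.Carrier ℓ) → IsSmall (Sub S A) → IsSmall (Sub S B) →
                IsSmall (Sub S (A ∪ B))
      ∪-small A B smallA smallB e = impossible
        where
        module e = Injection e

        InA InB : Pred K ℓ
        InA k = proj₁ (e.to k) ∈ A
        InB k = proj₁ (e.to k) ∈ B

        boundA : ∃ λ b → ∀ {k} → k ∈ InA → k < b
        boundA = small⇒bounded InA
          (small-↣ (Sub set InA) (Sub S A) (λ (k , k∈A) → _ , k∈A) e.injective smallA)

        boundB : ∃ λ b → ∀ {k} → k ∈ InB → k < b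
        boundB = small⇒bounded InB
          (small-↣ (Sub set InB) (Sub S B) (λ (k , k∈B) → _ , k∈B) e.injective smallB)

        outside : ∀ k → ¬ (k < proj₁ boundA) → ¬ (k < proj₁ boundB) → Empty.⊥
        outside k k≮a k≮b with proj₂ (e.to k)
        ... | inj₁ k∈A = k≮a (proj₂ boundA k∈A)
        ... | inj₂ k∈B = k≮b (proj₂ boundB k∈B)

        impossible : Empty.⊥
        impossible with compare (proj₁ boundA) (proj₁ boundB)
        ... | tri< _ _ b≮a = outside _ b≮a (<-irrefl refl)
        ... | tri≈ _ _ b≮a = outside _ b≮a (<-irrefl refl)
        ... | tri> a≮b _ _ = outside _ (<-irrefl refl) a≮b

      -- An injection of κ into the union sorts `K` into fibres by the index of the set that is hit.
      -- Each fibre is bounded, and the bounds for `i < k` form a small set, itself bounded by some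
      -- `b`.
      ⋃-small : ∀ k (A : K → Pred S.Carrier ℓ) → (∀ i → IsSmall (Sub S (A i))) →
                IsSmall (Sub S (λ x → ∃ λ i → i < k × x ∈ A i))
      ⋃-small k A small e =
        let b , below-b   = bound-of-bounds
            i , i<k , _ = proj₂ (e.to b)
        -- `b` lies in the fibre of its own index `i`, so it is below the bound of that fibre, which
        -- is below `b`.
        in <-irrefl refl (<-trans (proj₂ (bound i) refl) (below-b (i , i<k , refl)))
        where
        module e = Injection e

        index : K → K
        index m = proj₁ (proj₂ (e.to m))

        Fibre : K → Pred K ℓ
        Fibre i m = index m ≡ i

        bound : ∀ i → ∃ λ b → ∀ {m} → m ∈ Fibre i → m < b
        bound i = small⇒bounded (Fibre i)
          (small-↣ (Sub set (Fibre i)) (Sub S (A i))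
            (λ (m , eq) → _ , subst (λ i → proj₁ (e.to m) ∈ A i) eq (proj₂ (proj₂ (proj₂ (e.to m)))))
            e.injective (small i))

        Bounds : Pred K ℓ
        Bounds b = ∃ λ i → i < k × b ≡ proj₁ (bound i)

        bound-of-bounds : ∃ λ b → ∀ {c} → c ∈ Bounds → c < b
        bound-of-bounds = small⇒bounded Bounds
          (small-↣ (Sub set Bounds) (Sub set (_< k)) (λ (_ , i , i<k , _) → i , i<k)
            (λ { {_ , _ , _ , refl} {_ , _ , _ , refl} refl → refl }) (segment-small k))

-- Cuts and saturated subsets of a linear order.

module Partition {ℓ : Level} (em⁺ : ExcludedMiddle (lsuc ℓ))
                 (ext : Extensionality (lsuc ℓ) (lsuc ℓ))
                 (κ : Cardinal ℓ) (regular : Cardinal.Regular κ)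
                 (P : LinearOrder ℓ) where

  open Smallness em⁺ ext κ regular
  open StrictTotalOrder P using () renaming (Carrier to C; _<_ to _<ᴾ_; trans to <ᴾ-trans)

  Small : Pred C ℓ → Set ℓ
  Small A = IsSmall (Sub (underlying P) A)

  Between : Pred C ℓ → Pred C ℓ → Pred C ℓ
  Between A B c = (∀ {x} → x ∈ A → x <ᴾ c) × (∀ {y} → y ∈ B → c <ᴾ y)

  record Cut (S : Pred C ℓ) : Set (lsuc ℓ) where
    field
      left right  : Pred C ℓ
      left⊆       : left ⊆ S
      right⊆      : right ⊆ S
      left-small  : Small left
      right-small : Small right
      separated   : ∀ {x y} → x ∈ left → y ∈ right → x <ᴾ y

    Inside : Pred C ℓ
    Inside = Between left right

  open Cut

  widen : ∀ {S T} → S ⊆ T → Cut S → Cut T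
  widen S⊆T c = record
    { left        = left c
    ; right       = right c
    ; left⊆       = λ x∈ → S⊆T (left⊆ c x∈)
    ; right⊆      = λ x∈ → S⊆T (right⊆ c x∈)
    ; left-small  = left-small c
    ; right-small = right-small c
    ; separated   = separated c
    }

  -- Saturation of the suborder on `S`. A superset of a saturated set may fail to be saturated, so
  -- thinness below is stated for all subsets `T`.
  Sat : Pred C ℓ → Set (lsuc ℓ)
  Sat S = (c : Cut S) → ∃ λ x → x ∈ S × x ∈ Inside c

  abstract
    gap : ∀ {S} → ¬ Sat S → ∃ λ (c : Cut S) → ¬ (∃ λ x → x ∈ S × x ∈ Inside c)
    gap = ¬∀⇒∃¬ em em⁺

  sat-nonempty : K → ∀ {S} → Sat S → ∃ S
  sat-nonempty k₀ {S} sat = let x , x∈S , _ = sat trivial in x , x∈S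
    where
    ∅-small : Small (λ _ → ⊥)
    -- The empty set is small because `K` has the element `k₀`.
    ∅-small e = lower (proj₂ (Injection.to e k₀))

    trivial : Cut S
    trivial = record
      { left        = λ _ → ⊥
      ; right       = λ _ → ⊥
      ; left⊆       = λ ()
      ; right⊆      = λ ()
      ; left-small  = ∅-small
      ; right-small = ∅-small
      ; separated   = λ ()
      }

  -- Avoiding fewer than κ thin sets.

  module _ {S : Pred C ℓ} (sat : Sat S) (c₀ : Cut S) (N : K → Pred C ℓ)
           (thin : ∀ j T → T ⊆ S → T ⊆ N j → ¬ Sat T) where

    private
      Left Right : ∀ k → WfRec _<_ (λ _ → Cut S) k → Pred C ℓ
      Left  k h = left  c₀ ∪ λ x → ∃ λ i → Σ (i < k) λ i<k → x ∈ left  (h i<k)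
      Right k h = right c₀ ∪ λ x → ∃ λ i → Σ (i < k) λ i<k → x ∈ right (h i<k)

      -- Choosing each gap among the points inside `c₀` and all earlier gaps nests the gaps, so that
      -- their sides can be united into a single cut.
      Rest : ∀ k → WfRec _<_ (λ _ → Cut S) k → Pred C ℓ
      Rest k h = S ∩ N k ∩ Between (Left k h) (Right k h)

      IsGap : ∀ k → WfRec _<_ (λ _ → Cut S) k → Cut S → Set ℓ
      IsGap k h c = left c ⊆ Rest k h × right c ⊆ Rest k h ×
                    ¬ (∃ λ x → x ∈ Rest k h × x ∈ Inside c)

      next-gap : ∀ k (h : WfRec _<_ (λ _ → Cut S) k) → ∃ (IsGap k h)
      next-gap k h =
        let c , empty = gap (thin k (Rest k h) proj₁ (proj₁ ∘ proj₂))
        -- A cut of `Rest k h` is turned into one of `S`, the common type over which the recursion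
        -- runs.
        in widen proj₁ c , left⊆ c , right⊆ c , empty

      gaps : ∃ λ (g : K → Cut S) → ∀ k → IsGap k (λ {j} _ → g j) (g k)
      gaps = recursive-choice (lower-extensionality (lsuc ℓ) ℓ ext) IsGap next-gap

      g : K → Cut S
      g = proj₁ gaps

      left⊆Rest : ∀ k → left (g k) ⊆ Rest k (λ {j} _ → g j)
      left⊆Rest k = proj₁ (proj₂ gaps k)

      right⊆Rest : ∀ k → right (g k) ⊆ Rest k (λ {j} _ → g j)
      right⊆Rest k = proj₁ (proj₂ (proj₂ gaps k))

      limit : K → Cut S
      limit k = record
        { left        = Left k (λ {j} _ → g j)
        ; right       = Right k (λ {j} _ → g j)
        ; left⊆       = λ { (inj₁ x∈) → left⊆ c₀ x∈ ; (inj₂ (i , _ , x∈)) → left⊆ (g i) x∈ }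
        ; right⊆      = λ { (inj₁ x∈) → right⊆ c₀ x∈ ; (inj₂ (i , _ , x∈)) → right⊆ (g i) x∈ }
        ; left-small  = ∪-small (underlying P) _ _ (left-small c₀)
            (⋃-small (underlying P) k (left ∘ g) (left-small ∘ g))
        ; right-small = ∪-small (underlying P) _ _ (right-small c₀)
            (⋃-small (underlying P) k (right ∘ g) (right-small ∘ g))
        ; separated   = sep
        }
        where
        sep : ∀ {x y} → x ∈ Left k (λ {j} _ → g j) → y ∈ Right k (λ {j} _ → g j) → x <ᴾ y
        sep (inj₁ x∈) (inj₁ y∈) = separated c₀ x∈ y∈
        sep (inj₁ x∈) (inj₂ (j , _ , y∈)) =
          proj₁ (proj₂ (proj₂ (right⊆Rest j y∈))) (inj₁ x∈)
        sep (inj₂ (i , _ , x∈)) (inj₁ y∈) =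
          proj₂ (proj₂ (proj₂ (left⊆Rest i x∈))) (inj₁ y∈)
        -- Whichever gap comes later has its sides inside the earlier one.
        sep (inj₂ (i , _ , x∈)) (inj₂ (j , _ , y∈)) with compare i j
        ... | tri< i<j _ _ = proj₁ (proj₂ (proj₂ (right⊆Rest j y∈))) (inj₂ (i , i<j , x∈))
        ... | tri≈ _ refl _ = separated (g i) x∈ y∈
        ... | tri> _ _ j<i = proj₂ (proj₂ (proj₂ (left⊆Rest i x∈))) (inj₂ (j , j<i , y∈))

    abstract
      -- A point realising `limit k` is inside `c₀` and every gap `g j` with `j < k`. Were it in
      -- `N j`, it would belong to `Rest` at stage `j` and fill a gap that has no point there.
      avoid : ∀ k → ∃ λ x → x ∈ S × x ∈ Inside c₀ × (∀ {j} → j < k → x ∉ N j)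
      avoid k with x , x∈S , above , below ← sat (limit k) =
        x , x∈S , (above ∘ inj₁ , below ∘ inj₁) , λ {j} j<k x∈N →
          proj₂ (proj₂ (proj₂ gaps j))
            ( x
            , ( x∈S , x∈N
              , (λ { (inj₁ y∈) → above (inj₁ y∈)
                   ; (inj₂ (i , i<j , y∈)) → above (inj₂ (i , <-trans i<j j<k , y∈)) })
              , (λ { (inj₁ y∈) → below (inj₁ y∈)
                   ; (inj₂ (i , i<j , y∈)) → below (inj₂ (i , <-trans i<j j<k , y∈)) }))
            , (λ y∈ → above (inj₂ (j , j<k , y∈)))
            , (λ y∈ → below (inj₂ (j , j<k , y∈))))

  -- The sides of a cut are carried to `τ`, where they stay small, and the point found there is
  -- pulled back.
  saturated-≅ : (τ : LinearOrder ℓ) → P ≅ τ → Saturated κ τ → Sat (λ _ → ⊤)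
  saturated-≅ τ (to , iso) saturated c = x , tt , above , below
    where
    module τ = StrictTotalOrder τ
    open IsOrderIsomorphism iso using (mono; cancel; surjective) renaming (cong to to-cong)

    Image : Pred C ℓ → Pred τ.Carrier ℓ
    Image A t = ∃ λ a → a ∈ A × to a τ.≈ t

    image-small : ∀ {A} → Small A → Sub (underlying τ) (Image A) ≺ set
    image-small {A} small = small⇒≺ (Sub (underlying τ) (Image A))
      (small-↣ (Sub (underlying τ) (Image A)) (Sub (underlying P) A)
        (λ (_ , a , a∈A , _) → a , a∈A)
        (λ {(_ , _ , _ , a↦t)} {(_ , _ , _ , b↦u)} a≈b →
          τ.Eq.trans (τ.Eq.sym a↦t) (τ.Eq.trans (to-cong a≈b) b↦u))
        small)

    τ-point : ∃ λ t → (∀ {s} → s ∈ Image (left c) → s τ.< t) ×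
                      (∀ {s} → s ∈ Image (right c) → t τ.< s)
    τ-point = Saturated.between saturated (Image (left c)) (Image (right c))
      (image-small (left-small c)) (image-small (right-small c))
      λ (_ , a∈ , a↦s) (_ , b∈ , b↦t) →
        τ.<-respˡ-≈ a↦s (τ.<-respʳ-≈ b↦t (mono (separated c a∈ b∈)))

    preimage : ∃ λ x → to x τ.≈ proj₁ τ-point
    preimage = let x , eq = surjective (proj₁ τ-point) in
      x , eq (StrictTotalOrder.Eq.refl P)

    x : C
    x = proj₁ preimage

    above : ∀ {a} → a ∈ left c → a <ᴾ x
    above a∈ = cancel (τ.<-respʳ-≈ (τ.Eq.sym (proj₂ preimage))
      (proj₁ (proj₂ τ-point) (_ , a∈ , τ.Eq.refl)))

    below : ∀ {b} → b ∈ right c → x <ᴾ b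
    below b∈ = cancel (τ.<-respˡ-≈ (τ.Eq.sym (proj₂ preimage))
      (proj₂ (proj₂ τ-point) (_ , b∈ , τ.Eq.refl)))

  -- The graph of pairs of colour one and its cliques.

  module _ (f : Coloring P) where

    open StrictTotalOrder P using (_≈_; irrefl; module Eq)

    Edge : C → Pred C ℓ
    Edge x y = Σ (¬ (x ≈ y)) λ x≉y → Func.to f ((x , y) , x≉y) ≡ suc zero

    edge-sym : ∀ {x y} → y ∈ Edge x → x ∈ Edge y
    edge-sym (x≉y , one) =
      x≉y ∘ Eq.sym , trans (Func.cong f (inj₂ (Eq.refl , Eq.refl))) one

    -- Equality of pairs compares the points alone, so `f` cannot depend on the proof of
    -- distinctness.
    edge⇒one : ∀ {x y} → y ∈ Edge x → (x≉y : ¬ (x ≈ y)) → Func.to f ((x , y) , x≉y) ≡ suc zero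
    edge⇒one (_ , one) _ = trans (Func.cong f (inj₁ (Eq.refl , Eq.refl))) one

    ¬edge⇒zero : ∀ {x y} → y ∉ Edge x → (x≉y : ¬ (x ≈ y)) → Func.to f ((x , y) , x≉y) ≡ zero
    ¬edge⇒zero {x} {y} ¬edge x≉y with Func.to f ((x , y) , x≉y) in eq
    ... | zero     = refl
    ... | suc zero = contradiction (x≉y , eq) ¬edge

    record Clique (n : ℕ) (S : Pred C ℓ) : Set ℓ where
      field
        vertex  : Fin n → C
        vertex∈ : ∀ i → vertex i ∈ S
        edge    : ∀ {i j} → i ≢ j → vertex j ∈ Edge (vertex i)

    open Clique

    cone : ∀ {n S T x} → x ∈ S → T ⊆ S → T ⊆ Edge x → Clique n T → Clique (suc n) S
    cone {n} {S} {T} {x} x∈S T⊆S T⊆Edge v = record { vertex = v⁺ ; vertex∈ = v⁺∈ ; edge = edge⁺ }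
      where
      v⁺ : Fin (suc n) → C
      v⁺ zero    = x
      v⁺ (suc i) = vertex v i

      v⁺∈ : ∀ i → v⁺ i ∈ S
      v⁺∈ zero    = x∈S
      v⁺∈ (suc i) = T⊆S (vertex∈ v i)

      edge⁺ : ∀ {i j} → i ≢ j → v⁺ j ∈ Edge (v⁺ i)
      edge⁺ {zero}  {zero}  0≢0 = contradiction refl 0≢0
      edge⁺ {zero}  {suc j} _   = T⊆Edge (vertex∈ v j)
      edge⁺ {suc i} {zero}  _   = edge-sym (T⊆Edge (vertex∈ v i))
      edge⁺ {suc i} {suc j} i≢j = edge v (i≢j ∘ cong suc)

    -- Membership in `Q` records an index, which the bijection reads off; this is well defined
    -- because edges join distinct points.
    clique⇒homogeneous : ∀ {n S} → Clique n S →
      ∃ λ Q → Sub (underlying P) Q ≋ setoid (Fin n) × ConstantlyOn P f (suc zero) Q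
    clique⇒homogeneous {n} v = Q , bijection , one
      where
      Q : Pred C ℓ
      Q y = ∃ λ i → y ≡ vertex v i

      index-unique : ∀ {i j} → vertex v i ≈ vertex v j → i ≡ j
      index-unique {i} {j} vi≈vj =
        decidable-stable (i Fin.≟ j) λ i≢j → proj₁ (edge v i≢j) vi≈vj

      bijection : Sub (underlying P) Q ≋ setoid (Fin n)
      bijection = record
        { to        = λ (_ , i , _) → i
        ; cong      = λ { {_ , _ , refl} {_ , _ , refl} → index-unique }
        ; bijective = (λ { {_ , _ , refl} {_ , _ , refl} refl → Eq.refl })
                    , λ i → (_ , i , refl) , λ { {_ , _ , refl} → index-unique }
        }

      one : ConstantlyOn P f (suc zero) Q
      one (i , refl) (j , refl) vi≉vj = edge⇒one (edge v λ { refl → vi≉vj Eq.refl }) vi≉vj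

    -- Edgeless copies of φ, and the induction on clique size.

    module _ (φ : LinearOrder ℓ) where

      private module φ = StrictTotalOrder φ

      -- Preservation is enough: trichotomy in `φ` yields reflection of order and equality, and
      -- `edge-sym` covers pairs in the reverse order.
      record Copy : Set ℓ where
        field
          point      : φ.Carrier → C
          point-cong : ∀ {p q} → p φ.≈ q → point p ≈ point q
          point-mono : ∀ {p q} → p φ.< q → point p <ᴾ point q
          edgeless   : ∀ {p q} → p φ.< q → point q ∉ Edge (point p)

      copy⇒homogeneous : Copy → ∃ λ Q → SubOrder P Q ≅ φ × ConstantlyOn P f zero Q
      copy⇒homogeneous copy = Q , (index , isomorphism) , zero-on
        where
        open Copy copy

        Q : Pred C ℓ
        Q y = ∃ λ p → y ≡ point p

        index : Σ C Q → φ.Carrier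
        index (_ , p , _) = p

        ≈-reflect : ∀ {p q} → point p ≈ point q → p φ.≈ q
        ≈-reflect {p} {q} eq with φ.compare p q
        ... | tri< p<q _ _ = contradiction (point-mono p<q) (irrefl eq)
        ... | tri≈ _ p≈q _ = p≈q
        ... | tri> _ _ q<p = contradiction (point-mono q<p) (irrefl (Eq.sym eq))

        <-reflect : ∀ {p q} → point p <ᴾ point q → p φ.< q
        <-reflect {p} {q} lt with φ.compare p q
        ... | tri< p<q _ _ = p<q
        ... | tri≈ _ p≈q _ = contradiction lt (irrefl (point-cong p≈q))
        ... | tri> _ _ q<p = contradiction (<ᴾ-trans lt (point-mono q<p)) (irrefl Eq.refl)

        isomorphism : IsOrderIsomorphism (_≈_ on proj₁) φ._≈_ (_<ᴾ_ on proj₁) φ._<_ index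
        isomorphism = record
          { isOrderMonomorphism = record
            { isOrderHomomorphism = record
              { cong = λ { {_ , _ , refl} {_ , _ , refl} → ≈-reflect }
              ; mono = λ { {_ , _ , refl} {_ , _ , refl} → <-reflect }
              }
            ; injective = λ { {_ , _ , refl} {_ , _ , refl} → point-cong }
            ; cancel    = λ { {_ , _ , refl} {_ , _ , refl} → point-mono }
            }
          ; surjective = λ p → (_ , p , refl) , λ { {_ , _ , refl} → ≈-reflect }
          }

        zero-on : ConstantlyOn P f zero Q
        zero-on (p , refl) (q , refl) p≉q with φ.compare p q
        ... | tri< p<q _ _ = ¬edge⇒zero (edgeless p<q) p≉q
        ... | tri≈ _ p≈q _ = contradiction (point-cong p≈q) p≉q
        ... | tri> _ _ q<p = ¬edge⇒zero (edgeless q<p ∘ edge-sym) p≉q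

      module _ (size : HasSize φ κ) {S : Pred C ℓ} (sat : Sat S) (x₀ : ∃ S)
               (thin : ∀ {x} → x ∈ S → ∀ T → T ⊆ S → T ⊆ Edge x → ¬ Sat T) where

        private
          module size = Bijection size

          q : K → φ.Carrier
          q = size.to⁻

          to-q : ∀ k → size.to (q k) ≡ k
          to-q k = proj₂ (size.surjective k) φ.Eq.refl

          q-to : ∀ p → q (size.to p) φ.≈ p
          q-to p = size.injective (to-q (size.to p))

          Extends : K → K → ∃ S → ∃ S → Set ℓ
          Extends j k (x , _) (y , _) =
            (q j φ.< q k → x <ᴾ y) × (q k φ.< q j → y <ᴾ x) × y ∉ Edge x

          -- The points already placed form a cut, according to the side of `q k` on which their
          -- originals lie. Both sides are small, being indexed by a proper initial segment of κ.
          extend : ∀ k (g : K → ∃ S) → (∀ {i j} → i < j → j < k → Extends i j (g i) (g j)) →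
                   ∃ λ x → ∀ {j} → j < k → Extends j k (g j) x
          extend k g coherent =
            -- With this cut as `c₀`, one call of `avoid` settles both the position of the new point
            -- and the absence of edges to earlier ones.
            let x , x∈S , (above , below) , fresh = avoid sat cut (Edge ∘ proj₁ ∘ g) (thin ∘ proj₂ ∘ g) k
            in (x , x∈S) , λ {j} j<k →
              (λ qj<qk → above (j , j<k , qj<qk , refl)) ,
              (λ qk<qj → below (j , j<k , qk<qj , refl)) ,
              fresh j<k
            where
            Earlier : Pred φ.Carrier ℓ → Pred C ℓ
            Earlier R x = ∃ λ j → j < k × q j ∈ R × x ≡ proj₁ (g j)

            earlier⊆ : ∀ R → Earlier R ⊆ S
            earlier⊆ R (j , _ , _ , refl) = proj₂ (g j)

            earlier-small : ∀ R → Small (Earlier R)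
            earlier-small R = small-↣ (Sub (underlying P) (Earlier R)) (Sub set (_< k))
              (λ (_ , j , j<k , _) → j , j<k)
              (λ { {_ , _ , _ , _ , refl} {_ , _ , _ , _ , refl} refl → Eq.refl })
              (segment-small k)

            cut : Cut S
            cut = record
              { left        = Earlier (φ._< q k)
              ; right       = Earlier (q k φ.<_)
              ; left⊆       = earlier⊆ (φ._< q k)
              ; right⊆      = earlier⊆ (q k φ.<_)
              ; left-small  = earlier-small (φ._< q k)
              ; right-small = earlier-small (q k φ.<_)
              ; separated   = sep
              }
              where
              sep : ∀ {x y} → x ∈ Earlier (φ._< q k) → y ∈ Earlier (q k φ.<_) → x <ᴾ y
              -- The order of two earlier points was settled when the later one was placed.
              sep (i , i<k , qi<qk , refl) (j , j<k , qk<qj , refl) with compare i j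
              ... | tri< i<j _ _  = proj₁ (coherent i<j j<k) (φ.trans qi<qk qk<qj)
              ... | tri≈ _ refl _ = contradiction (φ.trans qi<qk qk<qj) (φ.irrefl φ.Eq.refl)
              ... | tri> _ _ j<i  = proj₁ (proj₂ (coherent j<i i<k)) (φ.trans qi<qk qk<qj)

          sequence : ∃ λ (g : K → ∃ S) → ∀ {j k} → j < k → Extends j k (g j) (g k)
          sequence = pairwise-choice x₀ Extends extend

          x : K → C
          x = proj₁ ∘ proj₁ sequence

          x-mono : ∀ {j k} → q j φ.< q k → x j <ᴾ x k
          x-mono {j} {k} qj<qk with compare j k
          ... | tri< j<k _ _  = proj₁ (proj₂ sequence j<k) qj<qk
          ... | tri≈ _ refl _ = contradiction qj<qk (φ.irrefl φ.Eq.refl)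
          ... | tri> _ _ k<j  = proj₁ (proj₂ (proj₂ sequence k<j)) qj<qk

          x-edgeless : ∀ {j k} → j ≢ k → x k ∉ Edge (x j)
          x-edgeless {j} {k} j≢k with compare j k
          ... | tri< j<k _ _ = proj₂ (proj₂ (proj₂ sequence j<k))
          ... | tri≈ _ j≡k _ = contradiction j≡k j≢k
          ... | tri> _ _ k<j = proj₂ (proj₂ (proj₂ sequence k<j)) ∘ edge-sym

        embed : Copy
        embed = record
          { point      = x ∘ size.to
          ; point-cong = Eq.reflexive ∘ cong x ∘ size.cong
          ; point-mono = λ {p} {p′} p<p′ → x-mono
              (φ.<-respˡ-≈ (φ.Eq.sym (q-to p)) (φ.<-respʳ-≈ (φ.Eq.sym (q-to p′)) p<p′))
          ; edgeless   = λ p<p′ → x-edgeless λ eq → φ.irrefl (size.injective eq) p<p′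
          }

      -- `S` varies in the induction, since the smaller clique is sought within the neighbours of
      -- one point. `Copy` does not mention `S`, so a copy found at a lower stage is passed on
      -- unchanged.
      copy-or-clique : K → HasSize φ κ → ∀ n {S} → Sat S → Copy ⊎ Clique n S
      copy-or-clique k₀ size zero sat =
        inj₂ (record { vertex = λ () ; vertex∈ = λ () ; edge = λ {i} → contradiction i λ () })
      copy-or-clique k₀ size (suc n) {S} sat
        with em⁺ {∃ λ x → Σ (x ∈ S) λ _ → ∃ λ T → T ⊆ S × T ⊆ Edge x × Sat T}
      -- Failure of the existential is exactly the thinness that `embed` assumes.
      ... | no ¬∃ = inj₁ (embed size sat (sat-nonempty k₀ sat)
                      λ x∈S T T⊆S T⊆Edge satT → ¬∃ (_ , x∈S , T , T⊆S , T⊆Edge , satT))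
      ... | yes (x , x∈S , T , T⊆S , T⊆Edge , satT) with copy-or-clique k₀ size n satT
      ...   | inj₁ copy   = inj₁ copy
      ...   | inj₂ clique = inj₂ (cone x∈S T⊆S T⊆Edge clique)

theorem2p9 : ∀ {ℓ : Level} → ExcludedMiddle (lsuc ℓ) → Extensionality (lsuc ℓ) (lsuc ℓ) →
    ∀ (κ : Cardinal ℓ) → Cardinal.Infinite κ → Cardinal.Regular κ →
    ∀ (φ : LinearOrder ℓ) → HasSize φ κ →
    ∀ (n : ℕ) (τ : LinearOrder ℓ) → Saturated κ τ →
    τ ⟶⟨ φ , n ⟩²
theorem2p9 em ext κ infinite regular φ size n τ saturated P P≅τ f =
  [ inj₁ ∘ copy⇒homogeneous f φ , inj₂ ∘ clique⇒homogeneous f ]′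
    -- The image of `0` is the inhabitant `k₀` of `K`; the induction starts from the whole of `P`.
    (copy-or-clique f φ (Injection.to infinite 0) size n (saturated-≅ τ P≅τ saturated))
  where open Partition em ext κ regular P
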